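{- Let $K$ be a finite simplicial complex, let $W:K\rightarrow K\cup\{0\}$ be an admissible discrete vector field over $K$, and let $h:K\rightarrow\mathbb{Z}_{\geq 0}$ be the height function associated to $W$. Then $h$ is a combinatorial Morse function over $K$ with gradient vector field $W$, i.e. $V_h=W$.
   Context: $K$ is identified with its set of (non-empty) simplices. Write $\sigma\prec\tau$ (or $\tau\succ\sigma$) if $\sigma$ is an immediate face of $\tau$ in $K$, i.e. $\sigma$ is a face of $\tau$ and $\dim(\sigma)=\dim(\tau)-1$. A discrete vector field over $K$ is a map $W:K\rightarrow K\cup\{0\}$ such that (W1) if $W(\sigma)\neq 0$ then $\sigma\prec W(\sigma)$; (W2) if $W(\sigma)=W(\sigma')\neq 0$ then $\sigma=\sigma'$; (W3) $W^2=0$, i.e. if $W(\sigma)\neq 0$ then $W(W(\sigma))=0$. A path of index $k$ relative to $W$ is a sequence of $k$-simplices $\sigma_0,\ldots,\sigma_r\in W^{ -1}(K)$ such that $\sigma_i\neq\sigma_{i+1}$ and $\sigma_{i+1}\prec W(\sigma_i)$ for all $0\leq i\leq r-1$. It is closed if $\sigma_0=\sigma_r$ and non-stationary if $r>0$. $W$ is admissible if it has no non-stationary closed paths (of any index). A combinatorial Morse function over $K$ is a map $f:K\rightarrow\mathbb{R}$ such that for every $\sigma\in K$: (M1) $|\{\eta\prec\sigma : f(\eta)\geq f(\sigma)\}|\leq 1$ and (M2) $|\{\tau\succ\sigma : f(\tau)\leq f(\sigma)\}|\leq 1$. Its gradient vector field $V_f$ is the discrete vector field given by $V_f(\sigma)=\tau$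 if $\tau\succ\sigma$ and $f(\sigma)\geq f(\tau)$, and $V_f(\sigma)=0$ if there is no such $\tau$. For an admissible $W$, let $\lessdot$ be the relation on $K$ obtained as the transitive closure of the following atomic relations: (1) $\sigma\lessdot\tau$ if $\sigma\prec\tau$; and (2) $\sigma\gtrdot\tau$ (i.e. $\tau\lessdot\sigma$) if $\tau=W(\sigma)$. Write $\sigma\mathbin{\dot{\sim}}\tau$ whenever $\sigma\lessdot\tau$ and $\sigma\gtrdot\tau$. The height function $h:K\rightarrow\mathbb{Z}_{\geq 0}$ associated to $W$ is defined by letting $h(\sigma)$ be the maximum $n\in\mathbb{Z}_{\geq 0}$ for which there exists a chain $\sigma=\sigma_n\gtrdot\sigma_{n-1}\gtrdot\cdots\gtrdot\sigma_0$ in $K$ such that $\sigma_i\mathbin{\dot{\sim}}\sigma_{i+1}$ does not hold for any $0\leq i\leq n-1$. -}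

module Defs where

open import Data.Bool.Properties using () renaming (_≟_ to _≟ᵇ_)
open import Data.Fin.Subset using (Subset; inside; outside; Nonempty; ∣_∣; _⊆_)
open import Data.Fin.Subset.Properties using (_⊆?_)
open import Data.List.Base using (List; []; _∷_; _++_; map; filter; length; head)
open import Data.List.Membership.Propositional using (_∈_; find; lose)
open import Data.List.Membership.Propositional.Properties
  using (∈-map⁺; ∈-map⁻; ∈-++⁺ˡ; ∈-++⁺ʳ)
open import Data.List.Relation.Unary.All as All using (All; []; _∷_)
open import Data.List.Relation.Unary.AllPairs using ([]; _∷_)
open import Data.List.Relation.Unary.Any as Any using (here; there)
open import Data.List.Relation.Unary.Unique.Propositional using (Unique)
import Data.List.Relation.Unary.Unique.Propositional.Properties as Unique
open import Data.Maybe.Base using (Maybe; just; nothing)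
import Data.Maybe.Properties as Maybe
open import Data.Nat.Base using (ℕ; zero; suc; pred; _≤_; _<_; z≤n; s≤s; s≤s⁻¹)
open import Data.Nat.Properties as ℕ using (_≟_)
open import Data.Product.Base using (∃-syntax; _×_; _,_; proj₁; proj₂)
open import Data.Sum.Base using (_⊎_; inj₁; inj₂)
open import Data.Vec.Base using ([]; _∷_)
import Data.Vec.Properties as Vec
open import Function.Base using (_∘_)
open import Level using (Level; 0ℓ)
open import Relation.Binary.Bundles using (DecTotalOrder)
open import Relation.Binary.Construct.Closure.Transitive as Plus
  using (TransClosure; [_]; _∷_)
open import Relation.Binary.Core using (Rel)
import Relation.Binary.Definitions as Binary
open import Relation.Binary.PropositionalEquality.Core
  using (_≡_; _≢_; refl; sym; trans; cong; subst)
open import Relation.Nullary.Decidable.Core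
  using (Dec; yes; no; map′; _×-dec_; _⊎-dec_; ¬?)
open import Relation.Nullary.Negation.Core using (¬_; contradiction; contradiction-irr)
open import Relation.Unary using (Pred; Decidable)

private
  variable
    a ℓ p q : Level
    A : Set a

------------------------------------------------------------------------
-- Finite simplicial complexes

-- The vertices are taken from Fin n; a point of Fin n need not itself
-- be a vertex of the complex.
record SimplicialComplex (n : ℕ) : Set₁ where
  field
    IsSimplex  : Pred (Subset n) 0ℓ
    isSimplex? : Decidable IsSimplex
    nonempty   : ∀ {s} → IsSimplex s → Nonempty s
    closed     : ∀ {s t} → IsSimplex t → s ⊆ t → Nonempty s → IsSimplex s

-- The membership proof is irrelevant, so simplices are equal as soon as
-- their vertex sets are.
record Simplex {n : ℕ} (K : SimplicialComplex n) : Set where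
  constructor simplex
  open SimplicialComplex K
  field
    vertices   : Subset n
    .isSimplex : IsSimplex vertices

open Simplex public using (vertices)

module _ {n : ℕ} {K : SimplicialComplex n} where

  open SimplicialComplex K

  vertices-injective : {σ τ : Simplex K} → vertices σ ≡ vertices τ → σ ≡ τ
  vertices-injective refl = refl

  infix 4 _≟ˢ_ _≺_ _≺?_

  _≟ˢ_ : Binary.DecidableEquality (Simplex K)
  σ ≟ˢ τ = map′ vertices-injective (cong vertices)
                (Vec.≡-dec _≟ᵇ_ (vertices σ) (vertices τ))

  dim : Simplex K → ℕ
  dim σ = pred ∣ vertices σ ∣

  _≺_ : Rel (Simplex K) 0ℓ
  σ ≺ τ = vertices σ ⊆ vertices τ × suc (dim σ) ≡ dim τ

  _≺?_ : Binary.Decidable _≺_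
  σ ≺? τ = (vertices σ ⊆? vertices τ) ×-dec (suc (dim σ) ≟ dim τ)

------------------------------------------------------------------------
-- The duplicate-free list of all simplices

subsets : ∀ n → List (Subset n)
subsets zero    = [] ∷ []
subsets (suc n) = map (inside ∷_) (subsets n) ++ map (outside ∷_) (subsets n)

∈-subsets : ∀ {n} (s : Subset n) → s ∈ subsets n
∈-subsets []            = here refl
∈-subsets (inside  ∷ s) = ∈-++⁺ˡ (∈-map⁺ (inside ∷_) (∈-subsets s))
∈-subsets (outside ∷ s) = ∈-++⁺ʳ _ (∈-map⁺ (outside ∷_) (∈-subsets s))

subsets-unique : ∀ n → Unique (subsets n)
subsets-unique zero    = [] ∷ []
subsets-unique (suc n) =
  Unique.++⁺ (Unique.map⁺ Vec.∷-injectiveʳ (subsets-unique n))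
             (Unique.map⁺ Vec.∷-injectiveʳ (subsets-unique n))
             disjoint
  where
  disjoint : ∀ {s} → ¬ (s ∈ map (inside ∷_) (subsets n) ×
                        s ∈ map (outside ∷_) (subsets n))
  disjoint (s∈ , s∈′) with ∈-map⁻ (inside ∷_) s∈ | ∈-map⁻ (outside ∷_) s∈′
  ... | _ , _ , refl | _ , _ , ()

module _ {n : ℕ} (K : SimplicialComplex n) where

  open SimplicialComplex K

  simplicesAmong : List (Subset n) → List (Simplex K)
  simplicesAmong []       = []
  simplicesAmong (s ∷ ss) with isSimplex? s
  ... | yes s∈K = simplex s s∈K ∷ simplicesAmong ss
  ... | no  _   = simplicesAmong ss

  simplices : List (Simplex K)
  simplices = simplicesAmong (subsets n)

module _ {n : ℕ} {K : SimplicialComplex n} where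

  open SimplicialComplex K

  ∈-simplices : (σ : Simplex K) → σ ∈ simplices K
  ∈-simplices (simplex s s∈K) = go (∈-subsets s)
    where
    go : ∀ {ss} → s ∈ ss → simplex s s∈K ∈ simplicesAmong K ss
    go {t ∷ _} s∈ with isSimplex? t | s∈
    ... | yes _   | here refl  = here refl
    ... | yes _   | there s∈ss = there (go s∈ss)
    ... | no  t∉K | here refl  = contradiction-irr s∈K t∉K
    ... | no  _   | there s∈ss = go s∈ss

  simplices-unique : Unique (simplices K)
  simplices-unique = go (subsets-unique n)
    where
    fresh : ∀ {s} .{s∈K} {ss} → All (s ≢_) ss →
            All (simplex s s∈K ≢_) (simplicesAmong K ss)
    fresh []                 = []
    fresh {ss = t ∷ _} (s≢t ∷ s≢) with isSimplex? t
    ... | yes _ = (s≢t ∘ cong vertices) ∷ fresh s≢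
    ... | no  _ = fresh s≢

    go : ∀ {ss} → Unique ss → Unique (simplicesAmong K ss)
    go []                      = []
    go {s ∷ _} (s≢ ∷ ss-unique) with isSimplex? s
    ... | yes _ = fresh s≢ ∷ go ss-unique
    ... | no  _ = go ss-unique

  anySimplex? : {P : Pred (Simplex K) p} → Decidable P → Dec (∃[ σ ] P σ)
  anySimplex? P? = map′ (λ any → let σ , _ , Pσ = find any in σ , Pσ)
                        (λ (σ , Pσ) → lose (∈-simplices σ) Pσ)
                        (Any.any? P? (simplices K))

------------------------------------------------------------------------
-- Discrete vector fields

-- nothing plays the role of the value 0.
record DiscreteVectorField {n : ℕ} (K : SimplicialComplex n) : Set where
  field
    field-at : Simplex K → Maybe (Simplex K)
    W1 : ∀ {σ τ} → field-at σ ≡ just τ → σ ≺ τ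
    W2 : ∀ {σ σ′ τ} → field-at σ ≡ just τ → field-at σ′ ≡ just τ → σ ≡ σ′
    W3 : ∀ {σ τ} → field-at σ ≡ just τ → field-at τ ≡ nothing

open DiscreteVectorField public using (field-at)

module _ {n : ℕ} {K : SimplicialComplex n} (W : DiscreteVectorField K) where

  infixr 5 step

  -- Path k σ ρ r: the paths σ = σ₀, …, σᵣ = ρ of index k.
  data Path (k : ℕ) : (σ ρ : Simplex K) (r : ℕ) → Set where
    point : ∀ {σ τ} → dim σ ≡ k → field-at W σ ≡ just τ → Path k σ σ 0
    step  : ∀ {σ τ σ′ ρ r} → dim σ ≡ k → field-at W σ ≡ just τ →
            σ ≢ σ′ → σ′ ≺ τ → Path k σ′ ρ r → Path k σ ρ (suc r)

  Admissible : Set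
  Admissible = ∀ {k σ r} → 0 < r → ¬ Path k σ σ r

------------------------------------------------------------------------
-- Combinatorial Morse functions and their gradients

-- Only the order of the values matters, so they may lie in any total
-- order; it is decidable so that the sets below can be counted.
module Morse {c ℓ₁ ℓ₂} (O : DecTotalOrder c ℓ₁ ℓ₂)
             {n : ℕ} {K : SimplicialComplex n}
             (f : Simplex K → DecTotalOrder.Carrier O) where

  open DecTotalOrder O using () renaming (_≤?_ to _≤ᶠ?_)

  upperFaces : Simplex K → List (Simplex K)
  upperFaces σ = filter (λ η → (η ≺? σ) ×-dec (f σ ≤ᶠ? f η)) (simplices K)

  lowerCofaces : Simplex K → List (Simplex K)
  lowerCofaces σ = filter (λ τ → (σ ≺? τ) ×-dec (f τ ≤ᶠ? f σ)) (simplices K)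

  record IsMorse : Set where
    field
      M1 : ∀ σ → length (upperFaces σ) ≤ 1
      M2 : ∀ σ → length (lowerCofaces σ) ≤ 1

  -- By M2 there is at most one candidate, so taking the head involves no
  -- choice when f is a Morse function.
  gradient : Simplex K → Maybe (Simplex K)
  gradient σ = head (lowerCofaces σ)

open Morse public using (IsMorse; gradient)

------------------------------------------------------------------------
-- The preorder of a discrete vector field and chains in it

module _ {n : ℕ} {K : SimplicialComplex n} (W : DiscreteVectorField K) where

  -- Below σ τ is σ ⋖ τ, and Chain σ m consists of the chains
  -- σ = σₘ ⋗ … ⋗ σ₀ without equivalent neighbours.
  data Atomic : Rel (Simplex K) 0ℓ where
    face  : ∀ {σ τ} → σ ≺ τ → Atomic σ τ
    arrow : ∀ {σ τ} → field-at W σ ≡ just τ → Atomic τ σ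

  Below : Rel (Simplex K) 0ℓ
  Below = TransClosure Atomic

  Equivalent : Rel (Simplex K) 0ℓ
  Equivalent σ τ = Below σ τ × Below τ σ

  data Chain : Simplex K → ℕ → Set where
    []  : ∀ {σ} → Chain σ 0
    _∷_ : ∀ {σ τ m} → Below τ σ × ¬ Equivalent τ σ → Chain τ m → Chain σ (suc m)

IsMaximum : Pred ℕ p → Pred ℕ p
IsMaximum P m = P m × (∀ {k} → P k → k ≤ m)

------------------------------------------------------------------------
-- Chains from a given simplex have a maximal length

private

  -- Warshall's algorithm: Via xs x y holds if y is reachable from x with
  -- all intermediate points in xs.
  module Warshall {A : Set a} (_≟ᴬ_ : Binary.DecidableEquality A)
                  {R : Rel A ℓ} (R? : Binary.Decidable R) where

    Via : List A → Rel A ℓ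
    Via []       x y = R x y
    Via (z ∷ zs) x y = Via zs x y ⊎ (Via zs x z × Via zs z y)

    via? : ∀ zs → Binary.Decidable (Via zs)
    via? []       x y = R? x y
    via? (z ∷ zs) x y = via? zs x y ⊎-dec (via? zs x z ×-dec via? zs z y)

    sound : ∀ zs {x y} → Via zs x y → TransClosure R x y
    sound []       r              = [ r ]
    sound (z ∷ zs) (inj₁ v)       = sound zs v
    sound (z ∷ zs) (inj₂ (v , w)) = sound zs v Plus.++ sound zs w

    lift : ∀ zs {x y} → R x y → Via zs x y
    lift []       r = r
    lift (_ ∷ zs) r = inj₁ (lift zs r)

    join : ∀ {zs x y z} → z ∈ zs → Via zs x z → Via zs z y → Via zs x y
    join {w ∷ zs} (here refl) v v′ = inj₂ (to v , from v′)
      where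
      to : ∀ {x} → Via (w ∷ zs) x w → Via zs x w
      to (inj₁ v)       = v
      to (inj₂ (v , _)) = v
      from : ∀ {y} → Via (w ∷ zs) w y → Via zs w y
      from (inj₁ v)       = v
      from (inj₂ (_ , v)) = v
    join (there z∈) (inj₁ v)       (inj₁ v′)        = inj₁ (join z∈ v v′)
    join (there z∈) (inj₁ v)       (inj₂ (v′ , v″)) = inj₂ (join z∈ v v′ , v″)
    join (there z∈) (inj₂ (v , v′)) (inj₁ v″)       = inj₂ (v , join z∈ v′ v″)
    join (there z∈) (inj₂ (v , _)) (inj₂ (_ , v′))  = inj₂ (v , v′)

    plus? : ∀ zs → (∀ z → z ∈ zs) → Binary.Decidable (TransClosure R)
    plus? zs ∈zs x y = map′ (sound zs) complete (via? zs x y)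
      where
      complete : ∀ {x y} → TransClosure R x y → Via zs x y
      complete [ r ]    = lift zs r
      complete (r ∷ rs) = join (∈zs _) (lift zs r) (complete rs)

  module _ {P : Pred A p} {Q : Pred A q} (P? : Decidable P) (Q? : Decidable Q)
           (P⊆Q : ∀ {x} → P x → Q x) where

    count-≤ : ∀ xs → length (filter P? xs) ≤ length (filter Q? xs)
    count-≤ []       = z≤n
    count-≤ (x ∷ xs) with P? x | Q? x
    ... | yes _  | yes _  = s≤s (count-≤ xs)
    ... | yes Px | no ¬Qx = contradiction (P⊆Q Px) ¬Qx
    ... | no _   | yes _  = ℕ.m≤n⇒m≤1+n (count-≤ xs)
    ... | no _   | no _   = count-≤ xs

    count-< : ∀ {x xs} → x ∈ xs → ¬ P x → Q x →
              length (filter P? xs) < length (filter Q? xs)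
    count-< {x} {_ ∷ xs} (here refl) ¬Px Qx with P? x | Q? x
    ... | yes Px | _      = contradiction Px ¬Px
    ... | no _   | yes _  = s≤s (count-≤ xs)
    ... | no _   | no ¬Qx = contradiction Qx ¬Qx
    count-< {x} {y ∷ xs} (there x∈) ¬Px Qx with P? y | Q? y
    ... | yes _  | yes _  = s≤s (count-< x∈ ¬Px Qx)
    ... | yes Py | no ¬Qy = contradiction (P⊆Q Py) ¬Qy
    ... | no _   | yes _  = ℕ.m≤n⇒m≤1+n (count-< x∈ ¬Px Qx)
    ... | no _   | no _   = count-< x∈ ¬Px Qx

  maximum : {P : Pred ℕ p} → Decidable P → P 0 →
            ∀ b → (∀ {k} → P k → k ≤ b) → ∃[ m ] IsMaximum P m
  maximum P? P0 zero    bound = 0 , P0 , bound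
  maximum {P = P} P? P0 (suc b) bound with P? (suc b)
  ... | yes Pb = suc b , Pb , bound
  ... | no ¬Pb = maximum P? P0 b λ Pk →
    s≤s⁻¹ (ℕ.≤∧≢⇒< (bound Pk) λ k≡b → ¬Pb (subst P k≡b Pk))

module _ {n : ℕ} {K : SimplicialComplex n} (W : DiscreteVectorField K) where

  atomic? : Binary.Decidable (Atomic W)
  atomic? σ τ = map′ (λ { (inj₁ σ≺τ) → face σ≺τ ; (inj₂ eq) → arrow eq })
                     (λ { (face σ≺τ) → inj₁ σ≺τ ; (arrow eq) → inj₂ eq })
                     ((σ ≺? τ) ⊎-dec Maybe.≡-dec _≟ˢ_ (field-at W τ) (just σ))

  below? : Binary.Decidable (Below W)
  below? = Warshall.plus? _≟ˢ_ atomic? (simplices K) ∈-simplices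

  private

    _▷_ : Rel (Simplex K) 0ℓ
    σ ▷ τ = Below W τ σ × ¬ Equivalent W τ σ

    _▷?_ : Binary.Decidable _▷_
    σ ▷? τ = below? τ σ ×-dec ¬? (below? τ σ ×-dec below? σ τ)

    ▷-irrefl : ∀ {σ} → ¬ (σ ▷ σ)
    ▷-irrefl (σ<σ , σ≁σ) = σ≁σ (σ<σ , σ<σ)

    ▷-trans : ∀ {σ τ ρ} → σ ▷ τ → τ ▷ ρ → σ ▷ ρ
    ▷-trans (τ<σ , _) (ρ<τ , ρ≁τ) =
      ρ<τ Plus.++ τ<σ , λ (_ , σ<ρ) → ρ≁τ (ρ<τ , τ<σ Plus.++ σ<ρ)

    #below : Simplex K → ℕ
    #below σ = length (filter (σ ▷?_) (simplices K))

    chain-bound : ∀ {σ m} → Chain W σ m → m ≤ #below σ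
    chain-bound []                      = z≤n
    chain-bound (_∷_ {σ} {τ} σ▷τ chain) = ℕ.≤-trans (s≤s (chain-bound chain))
      (count-< (τ ▷?_) (σ ▷?_) (▷-trans σ▷τ) (∈-simplices τ) ▷-irrefl σ▷τ)

  chain? : ∀ σ → Decidable (Chain W σ)
  chain? σ zero    = yes []
  chain? σ (suc m) = map′ (λ (_ , σ▷τ , chain) → σ▷τ ∷ chain)
                          (λ { (σ▷τ ∷ chain) → _ , σ▷τ , chain })
                          (anySimplex? λ τ → (σ ▷? τ) ×-dec chain? τ m)

  longestChain : ∀ σ → ∃[ m ] IsMaximum (Chain W σ) m
  longestChain σ = maximum (chain? σ) [] (#below σ) chain-bound

  height : Simplex K → ℕ
  height σ = proj₁ (longestChain σ)

{-# OPTIONS --safe #-}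
module Submission where

-- Everything reduces to one equivalence: for σ ≺ τ, the height satisfies
-- h τ ≤ h σ exactly when W σ = τ (height-inversion⇒arrow and
-- height-mono).  Given this, the exceptional cofaces of σ are the values
-- of W at σ, and the exceptional faces of σ are the preimages of σ under
-- W, of which there is at most one by W2.
--
-- The height is monotone for ⋖ and strictly so between inequivalent
-- simplices, hence the equivalence amounts to: if σ ≺ τ and τ ⋖ σ, then
-- W σ = τ (≺∧above⇒arrow).  Read a chain of atomic relations from σ down
-- to τ.  Each step either follows W, which raises the dimension by one,
-- or passes to an immediate face, which lowers it by one; by W3 no two
-- consecutive steps follow W.  So the dimension never exceeds dim σ + 1,
-- and it equals that value only if the two kinds of steps have alternated
-- so far, starting with W (locate).  Dropping stationary steps, τ = W ρ
-- for the end point ρ of a path starting at σ.  If ρ ≠ σ, then σ ≺ W ρ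
-- closes up this path, contradicting admissibility; so ρ = σ.

open import Defs
open import Data.List.Base using (List; []; _∷_; head; length)
open import Data.List.Membership.Propositional using (_∈_)
open import Data.List.Membership.Propositional.Properties using (∈-filter⁺; ∈-filter⁻)
open import Data.List.Relation.Unary.All using (_∷_)
open import Data.List.Relation.Unary.AllPairs using (_∷_)
open import Data.List.Relation.Unary.Any using (here; there)
open import Data.List.Relation.Unary.Unique.Propositional using (Unique)
open import Data.List.Relation.Unary.Unique.Propositional.Properties using (filter⁺)
open import Data.Maybe.Base using (Maybe; just; nothing)
open import Data.Maybe.Properties using (just-injective)
open import Data.Nat.Base using (ℕ; suc; _≤_; _<_; z≤n; s≤s)
open import Data.Nat.Properties
  using (≤-decTotalOrder; _≤?_; ≤-reflexive; ≤-trans; ≤-<-trans; <-irrefl; <-asym;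
         n<1+n; n≤1+n; <⇒≱; m≤n⇒m<n∨m≡n; suc-injective)
open import Data.Product.Base using (∃-syntax; _×_; _,_; proj₁; proj₂)
open import Data.Sum.Base using (inj₁; inj₂)
open import Relation.Binary.Construct.Closure.Transitive as Plus using ([_]; _∷_)
open import Relation.Binary.PropositionalEquality.Core
  using (_≡_; _≢_; refl; sym; trans)
open import Relation.Nullary.Decidable.Core using (yes; no; _×-dec_)
open import Relation.Nullary.Negation.Core using (¬_; contradiction)

unique∧constant⇒length≤1 : ∀ {a} {A : Set a} {xs : List A} → Unique xs →
                           (∀ {x y} → x ∈ xs → y ∈ xs → x ≡ y) → length xs ≤ 1
unique∧constant⇒length≤1 {xs = []}        _               _     = z≤n
unique∧constant⇒length≤1 {xs = _ ∷ []}    _               _     = s≤s z≤n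
unique∧constant⇒length≤1 {xs = _ ∷ _ ∷ _} ((x≢y ∷ _) ∷ _) const =
  contradiction (const (here refl) (there (here refl))) x≢y

head-unique : ∀ {a} {A : Set a} (xs : List A) (m : Maybe A) →
              (∀ {x} → x ∈ xs → m ≡ just x) → (∀ {x} → m ≡ just x → x ∈ xs) →
              head xs ≡ m
head-unique []      nothing  _     _        = refl
head-unique []      (just x) _     complete with () ← complete refl
head-unique (x ∷ _) m        sound _        = sym (sound (here refl))

module _ {n : ℕ} {K : SimplicialComplex n} (W : DiscreteVectorField K) where

  open DiscreteVectorField W using (W1; W2; W3)

  extend-path : ∀ {k σ ρ ρ′ τ τ′ r} → Path W k σ ρ r → field-at W ρ ≡ just τ →
                ρ ≢ ρ′ → ρ′ ≺ τ → dim ρ′ ≡ k → field-at W ρ′ ≡ just τ′ →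
                Path W k σ ρ′ (suc r)
  extend-path (point dimσ _) Wρ ρ≢ρ′ ρ′≺τ dimρ′ Wρ′ =
    step dimσ Wρ ρ≢ρ′ ρ′≺τ (point dimρ′ Wρ′)
  extend-path (step dimσ Wσ σ≢ ≺τ path) Wρ ρ≢ρ′ ρ′≺τ dimρ′ Wρ′ =
    step dimσ Wσ σ≢ ≺τ (extend-path path Wρ ρ≢ρ′ ρ′≺τ dimρ′ Wρ′)

  -- The possible positions of a simplex x ⋖ σ relative to σ: x has
  -- smaller dimension, the same dimension, or is W ρ for the end point ρ
  -- of a path from σ.  Paths only visit simplices where W does not vanish,
  -- so `level` asks for a path from σ to x just in that case.  In this way
  -- it also covers an x = W y of the dimension of σ, which no path need
  -- reach but where W vanishes by W3.
  data Position (σ x : Simplex K) : Set where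
    low   : dim x < dim σ → Position σ x
    level : dim x ≡ dim σ →
            (∀ {τ} → field-at W x ≡ just τ → ∃[ r ] Path W (dim σ) σ x r) →
            Position σ x
    top   : ∀ {ρ r} → field-at W ρ ≡ just x → Path W (dim σ) σ ρ r → Position σ x

  path-end-dim : ∀ {k σ ρ r} → Path W k σ ρ r → dim ρ ≡ k
  path-end-dim (point dimσ _)      = dimσ
  path-end-dim (step _ _ _ _ path) = path-end-dim path

  move : ∀ {σ x y} → Atomic W x y → Position σ y → Position σ x
  move (face (_ , 1+dimx)) (low y<σ) =
    low (≤-trans (≤-reflexive 1+dimx) (≤-trans (n≤1+n _) y<σ))
  move (face (_ , 1+dimx)) (level dimy _) = low (≤-reflexive (trans 1+dimx dimy))
  move {σ} {x} {y} (face x≺y) (top {ρ} Wρ path) = level dimx reach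
    where
    dimx : dim x ≡ dim σ
    dimx = trans (suc-injective (trans (proj₂ x≺y) (sym (proj₂ (W1 Wρ)))))
                 (path-end-dim path)

    -- A stationary step, x = ρ, is dropped.
    reach : ∀ {τ} → field-at W x ≡ just τ → ∃[ r ] Path W (dim σ) σ x r
    reach Wx with ρ ≟ˢ x
    ... | yes refl = _ , path
    ... | no ρ≢x   = _ , extend-path path Wρ ρ≢x x≺y dimx Wx
  move (arrow Wy) (low y<σ) with m≤n⇒m<n∨m≡n y<σ
  ... | inj₁ 1+y<σ = low (≤-<-trans (≤-reflexive (sym (proj₂ (W1 Wy)))) 1+y<σ)
  ... | inj₂ 1+y≡σ = level (trans (sym (proj₂ (W1 Wy))) 1+y≡σ)
                           λ Wx → contradiction (trans (sym Wx) (W3 Wy)) λ ()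
  move (arrow Wy) (level _ reach) = top Wy (proj₂ (reach Wy))
  move (arrow Wy) (top Wρ _)      = contradiction (trans (sym Wy) (W3 Wρ)) λ ()

  locate : ∀ {σ x} → Below W x σ → Position σ x
  locate [ x⋖σ ]       = move x⋖σ (level refl λ Wσ → 0 , point refl Wσ)
  locate (x⋖y ∷ y⋖⁺σ) = move x⋖y (locate y⋖⁺σ)

  -- An immediate face σ of τ can lie above τ only because of the arrow
  -- from σ to τ.
  ≺∧above⇒arrow : Admissible W → ∀ {σ τ} → σ ≺ τ → Below W τ σ →
                  field-at W σ ≡ just τ
  ≺∧above⇒arrow adm {σ} {τ} σ≺τ τ⋖σ with locate τ⋖σ
  ... | low τ<σ      = contradiction (≤-reflexive (proj₂ σ≺τ)) (<-asym τ<σ)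
  ... | level dimτ _ = contradiction (n<1+n (dim σ))
                                     (<-irrefl (sym (trans (proj₂ σ≺τ) dimτ)))
  ... | top {ρ} Wρ path with ρ ≟ˢ σ
  ...   | yes refl = Wρ
  ...   | no ρ≢σ   = contradiction (step (path-end-dim path) Wρ ρ≢σ σ≺τ path)
                                   (adm (s≤s z≤n))

  chain-lift : ∀ {σ τ m} → Below W τ σ → Chain W τ m → Chain W σ m
  chain-lift _   []                        = []
  chain-lift τ⋖σ ((ρ⋖τ , ρ≁τ) ∷ chain) =
    (ρ⋖τ Plus.++ τ⋖σ , λ (_ , σ⋖ρ) → ρ≁τ (ρ⋖τ , τ⋖σ Plus.++ σ⋖ρ)) ∷ chain

  height-mono : ∀ {σ τ} → Below W τ σ → height W τ ≤ height W σ
  height-mono {σ} {τ} τ⋖σ =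
    proj₂ (proj₂ (longestChain W σ)) (chain-lift τ⋖σ (proj₁ (proj₂ (longestChain W τ))))

  height-strict : ∀ {σ τ} → Below W τ σ → ¬ Below W σ τ → height W τ < height W σ
  height-strict {σ} {τ} τ⋖σ σ⋖̸τ =
    proj₂ (proj₂ (longestChain W σ))
          ((τ⋖σ , λ (_ , σ⋖τ) → σ⋖̸τ σ⋖τ) ∷ proj₁ (proj₂ (longestChain W τ)))

  height-inversion⇒arrow : Admissible W → ∀ {σ τ} → σ ≺ τ → height W τ ≤ height W σ →
                           field-at W σ ≡ just τ
  height-inversion⇒arrow adm {σ} {τ} σ≺τ hτ≤hσ with below? W τ σ
  ... | yes τ⋖σ = ≺∧above⇒arrow adm σ≺τ τ⋖σ
  ... | no τ⋖̸σ  = contradiction hτ≤hσ (<⇒≱ (height-strict [ face σ≺τ ] τ⋖̸σ))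

  private
    module M = Morse ≤-decTotalOrder (height W)

  ∈-upperFaces⇒arrow : Admissible W → ∀ {σ η} → η ∈ M.upperFaces σ →
                       field-at W η ≡ just σ
  ∈-upperFaces⇒arrow adm {σ} η∈
    with _ , η≺σ , hσ≤hη ← ∈-filter⁻ (λ η → (η ≺? σ) ×-dec (height W σ ≤? height W η))
                                     {xs = simplices K} η∈
    = height-inversion⇒arrow adm η≺σ hσ≤hη

  ∈-lowerCofaces⇒arrow : Admissible W → ∀ {σ τ} → τ ∈ M.lowerCofaces σ →
                         field-at W σ ≡ just τ
  ∈-lowerCofaces⇒arrow adm {σ} τ∈
    with _ , σ≺τ , hτ≤hσ ← ∈-filter⁻ (λ τ → (σ ≺? τ) ×-dec (height W τ ≤? height W σ))
                                     {xs = simplices K} τ∈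
    = height-inversion⇒arrow adm σ≺τ hτ≤hσ

  arrow⇒∈-lowerCofaces : ∀ {σ τ} → field-at W σ ≡ just τ → τ ∈ M.lowerCofaces σ
  arrow⇒∈-lowerCofaces {σ} {τ} Wσ =
    ∈-filter⁺ (λ τ → (σ ≺? τ) ×-dec (height W τ ≤? height W σ)) (∈-simplices τ)
              (W1 Wσ , height-mono [ arrow Wσ ])

  height-isMorse : Admissible W → IsMorse ≤-decTotalOrder (height W)
  height-isMorse adm = record
    { M1 = λ σ → unique∧constant⇒length≤1 (filter⁺ _ simplices-unique) λ η∈ η′∈ →
             W2 (∈-upperFaces⇒arrow adm η∈) (∈-upperFaces⇒arrow adm η′∈)
    ; M2 = λ σ → unique∧constant⇒length≤1 (filter⁺ _ simplices-unique) λ τ∈ τ′∈ →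
             just-injective (trans (sym (∈-lowerCofaces⇒arrow adm τ∈))
                                   (∈-lowerCofaces⇒arrow adm τ′∈))
    }

theorem3 : ∀ {n : ℕ} (K : SimplicialComplex n) (W : DiscreteVectorField K) →
    Admissible W →
    IsMorse ≤-decTotalOrder (height W) ×
    (∀ (σ : Simplex K) → gradient ≤-decTotalOrder (height W) σ ≡ field-at W σ)
theorem3 K W adm =
  height-isMorse W adm ,
  λ σ → head-unique _ (field-at W σ) (∈-lowerCofaces⇒arrow W adm) (arrow⇒∈-lowerCofaces W)
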